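{- Let $m,n\geq 1$ and $R\cong S\times T$ with $S=\prod_{i=1}^{m}R_{i}$ and $T=\prod_{j=1}^{n}\mathbb{F}_{j}$, where each $R_i$ is a local principal ideal ring with finitely many ideals that is not a field and each $\mathbb{F}_j$ is a field; let $n_i$ be the number of non-trivial (nonzero proper) ideals of $R_i$. Then $sdim(G(R))=\left(\prod_{i=1}^{m}(n_{i}+2)\right)2^{n}-2^{m+n-1}-2$.
   Context: All rings are commutative with identity. $I(R)$ is the set of non-trivial (nonzero proper) ideals of $R$; $G(R)$ is the graph with vertex set $I(R)$ in which distinct $I,J$ are adjacent iff $I\cap J\neq 0$. For a graph $G$ with distance $d$, two vertices $u,v$ are strongly resolved by a vertex $w$ if $d(w,u)=d(w,v)+d(v,u)$ or $d(w,v)=d(w,u)+d(u,v)$. A set $W$ of vertices is a strong resolving set if every two distinct vertices are strongly resolved by some vertex of $W$; $sdim(G)$ is the minimum cardinality of a strong resolving set. -}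

module Defs where

open import Level using (Level; _⊔_) renaming (suc to lsuc)
open import Algebra.Bundles using (CommutativeRing)
open import Algebra.Morphism.Structures using (module RingMorphisms)
import Algebra.Construct.DirectProduct as DP
open import Data.Nat using (ℕ; zero; suc; _≤_) renaming (_+_ to _+ℕ_)
open import Data.Fin using (Fin; zero; suc)
open import Data.List using (List; length)
open import Data.List.Relation.Unary.Any using (Any)
open import Data.List.Relation.Unary.AllPairs using (AllPairs)
open import Data.Product using (Σ; ∃; _×_; _,_; proj₁)
open import Data.Sum using (_⊎_)
open import Relation.Nullary using (¬_)
open import Relation.Binary.PropositionalEquality using (_≡_)

private variable c ℓ : Level

ΠRing : (k : ℕ) → (Fin (suc k) → CommutativeRing c ℓ) → CommutativeRing c ℓ
ΠRing zero    f = f zero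
ΠRing (suc k) f = DP.commutativeRing (f zero) (ΠRing k (λ i → f (suc i)))

_×R_ : CommutativeRing c ℓ → CommutativeRing c ℓ → CommutativeRing c ℓ
R ×R S = DP.commutativeRing R S

_≅R_ : CommutativeRing c ℓ → CommutativeRing c ℓ → Set (c ⊔ ℓ)
R ≅R S = ∃ λ (f : CommutativeRing.Carrier R → CommutativeRing.Carrier S) →
  RingMorphisms.IsRingIsomorphism (CommutativeRing.rawRing R) (CommutativeRing.rawRing S) f

module _ (R : CommutativeRing c ℓ) where
  open CommutativeRing R

  record Ideal : Set (lsuc (c ⊔ ℓ)) where
    field
      _∈I     : Carrier → Set (c ⊔ ℓ)
      ∈-resp  : ∀ {x y} → x ≈ y → x ∈I → y ∈I
      0∈      : 0# ∈I
      +-closed : ∀ {x y} → x ∈I → y ∈I → (x + y) ∈I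
      *-closed : ∀ r {x} → x ∈I → (r * x) ∈I
  open Ideal public

  _⊆I_ : Ideal → Ideal → Set (c ⊔ ℓ)
  I ⊆I J = ∀ x → (I ∈I) x → (J ∈I) x

  _≐_ : Ideal → Ideal → Set (c ⊔ ℓ)
  I ≐ J = (I ⊆I J) × (J ⊆I I)

  NonzeroIdeal : Ideal → Set (c ⊔ ℓ)
  NonzeroIdeal I = ¬ (∀ x → (I ∈I) x → x ≈ 0#)

  ProperIdeal : Ideal → Set (c ⊔ ℓ)
  ProperIdeal I = ¬ (I ∈I) 1#

  Nontrivial : Ideal → Set (c ⊔ ℓ)
  Nontrivial I = NonzeroIdeal I × ProperIdeal I

  IsMaximal : Ideal → Set (lsuc (c ⊔ ℓ))
  IsMaximal M = ProperIdeal M × (∀ J → M ⊆I J → ProperIdeal J → J ⊆I M)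

  IsLocal : Set (lsuc (c ⊔ ℓ))
  IsLocal = Σ Ideal λ M → IsMaximal M × (∀ M′ → IsMaximal M′ → M′ ≐ M)

  IsPrincipalIdealRing : Set (lsuc (c ⊔ ℓ))
  IsPrincipalIdealRing = ∀ (I : Ideal) → ∃ λ a →
    ∀ x → ((I ∈I) x → ∃ λ r → x ≈ r * a) × ((∃ λ r → x ≈ r * a) → (I ∈I) x)

  HasFinitelyManyIdeals : Set (lsuc (c ⊔ ℓ))
  HasFinitelyManyIdeals = Σ (List Ideal) λ Is → ∀ I → Any (I ≐_) Is

  IsField : Set (c ⊔ ℓ)
  IsField = (¬ 1# ≈ 0#) × (∀ x → ¬ x ≈ 0# → ∃ λ y → x * y ≈ 1#)

  NumNontrivialIdeals : ℕ → Set (lsuc (c ⊔ ℓ))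
  NumNontrivialIdeals k = Σ (Fin k → Ideal) λ Is →
      (∀ i → Nontrivial (Is i))
    × (∀ i j → Is i ≐ Is j → i ≡ j)
    × (∀ I → Nontrivial I → ∃ λ i → I ≐ Is i)

  Vertex : Set (lsuc (c ⊔ ℓ))
  Vertex = Σ Ideal Nontrivial

  _≐V_ : Vertex → Vertex → Set (c ⊔ ℓ)
  u ≐V v = proj₁ u ≐ proj₁ v

  Adj : Vertex → Vertex → Set (c ⊔ ℓ)
  Adj u v = (¬ u ≐V v) ×
    ¬ (∀ x → (proj₁ u ∈I) x → (proj₁ v ∈I) x → x ≈ 0#)

  data Walk : Vertex → Vertex → ℕ → Set (lsuc (c ⊔ ℓ)) where
    here  : ∀ {u v} → u ≐V v → Walk u v 0
    step  : ∀ {u w v k} → Adj u w → Walk w v k → Walk u (v) (suc k)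

  Dist : Vertex → Vertex → ℕ → Set (lsuc (c ⊔ ℓ))
  Dist u v k = Walk u v k × (∀ j → Walk u v j → k ≤ j)

  StronglyResolves : Vertex → Vertex → Vertex → Set (lsuc (c ⊔ ℓ))
  StronglyResolves w u v =
      (∃ λ a → ∃ λ b → ∃ λ e → Dist w u a × Dist w v b × Dist v u e × a ≡ b +ℕ e)
    ⊎ (∃ λ a → ∃ λ b → ∃ λ e → Dist w v a × Dist w u b × Dist u v e × a ≡ b +ℕ e)

  IsStrongResolvingSet : List Vertex → Set (lsuc (c ⊔ ℓ))
  IsStrongResolvingSet W =
    ∀ u v → ¬ u ≐V v → Any (λ w → StronglyResolves w u v) W

  -- a finite set of vertices, given as a duplicate-free list
  DistinctVertices : List Vertex → Set (lsuc (c ⊔ ℓ))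
  DistinctVertices W = AllPairs (λ u v → ¬ u ≐V v) W

  SDimIs : ℕ → Set (lsuc (c ⊔ ℓ))
  SDimIs k =
      (Σ (List Vertex) λ W → DistinctVertices W × IsStrongResolvingSet W × length W ≡ k)
    × (∀ W → DistinctVertices W → IsStrongResolvingSet W → k ≤ length W)

{-# OPTIONS --safe #-}
module Submission where

-- An ideal of R is a tuple of ideals of the factors; call the set of coordinates where it is
-- nonzero its support. In each factor divisibility is total, so nonzero ideals meet, and two
-- ideals of R meet iff their supports do. Hence G(R) has diameter at most 2 (the ideal that is
-- nontrivial in the first coordinate and whole elsewhere is adjacent to everything else), and a
-- strong resolving set must contain one of any two vertices with equal or disjoint supports.
-- Its complement is therefore a family of vertices with distinct, pairwise meeting supports, so
-- has at most 2^(m+n-1) members; removing one vertex for every support through the first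
-- coordinate attains this bound. The argument is classical, but the hypotheses imply excluded
-- middle: see principal⇒excludedMiddle.

open import Defs
open import Level using (Level; _⊔_; Lift; lift; lower) renaming (suc to lsuc)
open import Algebra.Bundles using (CommutativeRing)
open import Algebra.Morphism.Structures using (module RingMorphisms)
import Algebra.Properties.CommutativeSemigroup as CommutativeSemigroupProperties
import Algebra.Properties.Ring as RingProperties
open import Axiom.ExcludedMiddle using (ExcludedMiddle)
open import Data.Bool using (Bool; true; false; not; _∧_) renaming (_≟_ to _≟ᵇ_)
open import Data.Bool.Properties using (∧-comm; ∧-inverseʳ; not-injective)
open import Data.Empty using (⊥)
open import Data.Nat using (ℕ; zero; suc; _∸_; _^_; _≤_; z≤n; s≤s)
open import Data.Nat.Properties as ℕ using (+-suc; +-mono-≤; ≤-trans; ≤-reflexive; ≤-antisym; m≤n+o⇒m∸n≤o; m+n∸m≡n; ∸-+-assoc)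
open import Data.Fin using (Fin; zero; suc; combine; remQuot; _≟_)
open import Data.Fin.Properties using (remQuot-combine; combine-remQuot)
open import Data.Nat.ListAction using (product)
open import Data.List as List using (List; []; _∷_; map; allFin; length; filter)
open import Data.List.Properties using (length-++; length-map; length-tabulate; map-tabulate)
open import Data.List.Membership.Propositional using (_∈_; _∉_; find; lose)
open import Data.List.Membership.Propositional.Properties using (∈-map⁺; ∈-map⁻; ∈-++⁺ˡ; ∈-++⁺ʳ; ∈-++⁻; ∈-∃++; ∈-filter⁺; ∈-allFin)
import Data.List.Membership.DecPropositional as DecMembership
open import Data.List.Relation.Binary.Subset.Propositional using (_⊆_)
open import Data.List.Relation.Unary.All as All using (All; []; _∷_)
import Data.List.Relation.Unary.All.Properties as All
open import Data.List.Relation.Unary.AllPairs using (AllPairs; []; _∷_)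
open import Data.List.Relation.Unary.Any as Any using (Any; here; there)
import Data.List.Relation.Unary.Any.Properties as Any
open import Data.List.Relation.Unary.Unique.Propositional using (Unique)
import Data.List.Relation.Unary.Unique.Propositional.Properties as Unique
open import Data.Product using (Σ; ∃; ∃₂; _×_; _,_; proj₁; proj₂)
open import Data.Sum as Sum using (_⊎_; inj₁; inj₂; [_,_])
open import Data.Unit.Polymorphic using (⊤)
open import Data.Vec as Vec using (Vec; []; _∷_; _++_; take; drop; replicate)
open import Data.Vec.Properties using (take++drop≡id; ∷-injectiveˡ; ∷-injectiveʳ)
open import Data.Vec.Relation.Binary.Pointwise.Inductive as Pointwise using (Pointwise; []; _∷_)
open import Function using (_∘_; id; case_of_)
open import Relation.Binary.PropositionalEquality using (_≡_; _≢_; refl; sym; trans; cong; cong₂; subst; subst₂; ≢-sym)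
open import Relation.Nullary using (¬_; Dec; yes; no; contradiction; ¬?; _×-dec_)
open import Relation.Nullary.Decidable using (map′)

private variable
  c ℓ : Level

-- Supports are bit vectors. `Disjoint v v` serves throughout as the statement that `v` is empty.
Disjoint : {n : ℕ} → Vec Bool n → Vec Bool n → Set
Disjoint = Pointwise (λ a b → a ∧ b ≡ false)

-- Ideals and divisibility in a single ring

module _ (A : CommutativeRing c ℓ) where
  open CommutativeRing A hiding (zero) renaming (refl to ≈-refl; sym to ≈-sym; trans to ≈-trans)
  open CommutativeSemigroupProperties +-commutativeSemigroup using (interchange)
  open RingProperties ring using (-‿distribˡ-*)

  infix 4 _∣A_
  _∣A_ : Carrier → Carrier → Set (c ⊔ ℓ)
  a ∣A b = ∃ λ r → b ≈ r * a

  TotalDivisibility : Set (c ⊔ ℓ)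
  TotalDivisibility = ∀ a b → a ∣A b ⊎ b ∣A a

  TrivialMeet : Ideal A → Ideal A → Set (c ⊔ ℓ)
  TrivialMeet I J = ∀ x → (I ∈I) x → (J ∈I) x → x ≈ 0#

  ≐-refl : ∀ {I} → _≐_ A I I
  ≐-refl = (λ _ p → p) , (λ _ p → p)

  ≐-sym : ∀ {I J} → _≐_ A I J → _≐_ A J I
  ≐-sym (f , g) = g , f

  ≐-trans : ∀ {I J K} → _≐_ A I J → _≐_ A J K → _≐_ A I K
  ≐-trans (f , g) (h , k) = (λ x → h x ∘ f x) , (λ x → g x ∘ k x)

  zeroIdeal : Ideal A
  zeroIdeal = record
    { _∈I = λ x → Lift c (x ≈ 0#)
    ; ∈-resp = λ x≈y p → lift (≈-trans (≈-sym x≈y) (lower p))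
    ; 0∈ = lift ≈-refl
    ; +-closed = λ p q → lift (≈-trans (+-cong (lower p) (lower q)) (+-identityˡ 0#))
    ; *-closed = λ r p → lift (≈-trans (*-congˡ (lower p)) (zeroʳ r))
    }

  unitIdeal : Ideal A
  unitIdeal = record
    { _∈I = λ _ → ⊤ ; ∈-resp = λ _ _ → _ ; 0∈ = _ ; +-closed = λ _ _ → _ ; *-closed = λ _ _ → _ }

  1∈⇒∈ : ∀ (I : Ideal A) → (I ∈I) 1# → ∀ x → (I ∈I) x
  1∈⇒∈ I p x = ∈-resp I (*-identityʳ x) (*-closed I x p)

  ideal₂ : Carrier → Carrier → Ideal A
  ideal₂ a b = record
    { _∈I = λ x → ∃₂ λ r s → x ≈ r * a + s * b
    ; ∈-resp = λ { x≈y (r , s , e) → r , s , ≈-trans (≈-sym x≈y) e }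
    ; 0∈ = 0# , 0# , ≈-sym (≈-trans (+-cong (zeroˡ a) (zeroˡ b)) (+-identityˡ 0#))
    ; +-closed = λ { (r , s , e) (r′ , s′ , e′) → r + r′ , s + s′ ,
        ≈-trans (+-cong e e′) (≈-trans (interchange _ _ _ _)
          (+-cong (≈-sym (distribʳ a r r′)) (≈-sym (distribʳ b s s′)))) }
    ; *-closed = λ { t (r , s , e) → t * r , t * s ,
        ≈-trans (*-congˡ e) (≈-trans (distribˡ t _ _)
          (+-cong (≈-sym (*-assoc t r a)) (≈-sym (*-assoc t s b)))) }
    }

  principal : Carrier → Ideal A
  principal a = record
    { _∈I = a ∣A_
    ; ∈-resp = λ { x≈y (r , e) → r , ≈-trans (≈-sym x≈y) e }
    ; 0∈ = 0# , ≈-sym (zeroˡ a)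
    ; +-closed = λ { (r , e) (s , f) → r + s , ≈-trans (+-cong e f) (≈-sym (distribʳ a r s)) }
    ; *-closed = λ { t (r , e) → t * r , ≈-trans (*-congˡ e) (≈-sym (*-assoc t r a)) }
    }

  local⇒1≉0 : IsLocal A → ¬ 1# ≈ 0#
  local⇒1≉0 (M , (M≠1 , _) , _) 1≈0 = M≠1 (∈-resp M (≈-sym 1≈0) (0∈ M))

  -- A generator of {x | x ≈ 0 or P} lies in it, so it is 0 (refuting P) or witnesses P.
  principal⇒excludedMiddle : ¬ 1# ≈ 0# → IsPrincipalIdealRing A → ExcludedMiddle (c ⊔ ℓ)
  principal⇒excludedMiddle 1≉0 pir {P} = decide (proj₂ (spec a) (1# , ≈-sym (*-identityˡ a)))
    where
    I : Ideal A
    I = record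
      { _∈I = λ x → x ≈ 0# ⊎ P
      ; ∈-resp = λ { x≈y (inj₁ e) → inj₁ (≈-trans (≈-sym x≈y) e) ; _ (inj₂ p) → inj₂ p }
      ; 0∈ = inj₁ ≈-refl
      ; +-closed = λ { (inj₁ e) (inj₁ f) → inj₁ (≈-trans (+-cong e f) (+-identityˡ 0#))
                     ; (inj₁ _) (inj₂ p) → inj₂ p ; (inj₂ p) _ → inj₂ p }
      ; *-closed = λ { r (inj₁ e) → inj₁ (≈-trans (*-congˡ e) (zeroʳ r)) ; _ (inj₂ p) → inj₂ p }
      }
    a : Carrier
    a = proj₁ (pir I)
    spec = proj₂ (pir I)
    decide : a ≈ 0# ⊎ P → Dec P
    decide (inj₂ p) = yes p
    decide (inj₁ a≈0) = no λ p → let (r , e) = proj₁ (spec 1#) (inj₂ p) in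
      1≉0 (≈-trans e (≈-trans (*-congˡ a≈0) (zeroʳ r)))

  module _ (em : ExcludedMiddle (c ⊔ ℓ)) where

    em₀ : (x : Carrier) → Dec (x ≈ 0#)
    em₀ x = map′ lower lift (em {Lift c (x ≈ 0#)})

    nonzeroElement : ∀ {I} → NonzeroIdeal A I → ∃ λ x → (I ∈I) x × ¬ x ≈ 0#
    nonzeroElement {I} I≠0 with em {∃ λ x → (I ∈I) x × ¬ x ≈ 0#}
    ... | yes p = p
    ... | no ¬p = contradiction zeroI I≠0
      where
      zeroI : ∀ x → (I ∈I) x → x ≈ 0#
      zeroI x x∈I with em₀ x
      ... | yes e = e
      ... | no x≉0 = contradiction (x , x∈I , x≉0) ¬p

    -- One greedy pass: the current ideal is replaced by `J` whenever `J` is proper and contains it.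
    -- A rejected `J` stays rejected, because the current ideal only grows.
    properExtension : ∀ Js I → ProperIdeal A I → ∃ λ K → ProperIdeal A K × _⊆I_ A I K ×
      All (λ J → _⊆I_ A K J → ProperIdeal A J → _⊆I_ A J K) Js
    properExtension [] I I≠1 = I , I≠1 , (λ _ p → p) , []
    properExtension (J ∷ Js) I I≠1 with em {_⊆I_ A I J × ProperIdeal A J}
    ... | yes (I⊆J , J≠1) = let (K , K≠1 , J⊆K , max) = properExtension Js J J≠1 in
      K , K≠1 , (λ x → J⊆K x ∘ I⊆J x) , (λ _ _ → J⊆K) ∷ max
    ... | no ¬p = let (K , K≠1 , I⊆K , max) = properExtension Js I I≠1 in
      K , K≠1 , I⊆K , (λ K⊆J J≠1 → contradiction ((λ x → K⊆J x ∘ I⊆K x) , J≠1) ¬p) ∷ max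

    -- Every ideal equals a listed one, so maximality against the list is maximality.
    maximalExtension : HasFinitelyManyIdeals A → ∀ I → ProperIdeal A I →
      ∃ λ K → IsMaximal A K × _⊆I_ A I K
    maximalExtension (Js , complete) I I≠1 =
      let (K , K≠1 , I⊆K , max) = properExtension Js I I≠1 in
      K , (K≠1 , λ J K⊆J J≠1 x x∈J →
        let (max′ , J⊆J′ , J′⊆J) = All.lookupAny max (complete J) in
        max′ (λ y → J⊆J′ y ∘ K⊆J y) (J≠1 ∘ J′⊆J 1#) x (J⊆J′ x x∈J)) , I⊆K

    -- With (a , b) = (d), a = a′ d, b = b′ d and d = r a + s b, the element r a′ + s b′ fixes d;
    -- if neither a′ nor b′ is a unit then 1 − (r a′ + s b′) is, whence d = 0.
    local⇒totalDivisibility : IsLocal A → IsPrincipalIdealRing A → HasFinitelyManyIdeals A →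
      TotalDivisibility
    local⇒totalDivisibility (M , (M≠1 , _) , M-unique) pir fin a b = result
      where
      -- A non-unit generates a proper ideal; this lies in a maximal ideal, which can only be `M`.
      unit : ∀ x → ¬ (M ∈I) x → x ∣A 1#
      unit x x∉M with em {x ∣A 1#}
      ... | yes p = p
      ... | no ¬p = let (K , K-max , x⊆K) = maximalExtension fin (principal x) ¬p in
        contradiction (proj₁ (M-unique K K-max) x (x⊆K x (1# , ≈-sym (*-identityˡ x)))) x∉M
      d : Carrier
      d = proj₁ (pir (ideal₂ a b))
      spec = proj₂ (pir (ideal₂ a b))
      d∣a : d ∣A a
      d∣a = proj₁ (spec a) (1# , 0# ,
        ≈-sym (≈-trans (+-cong (*-identityˡ a) (zeroˡ b)) (+-identityʳ a)))
      d∣b : d ∣A b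
      d∣b = proj₁ (spec b) (0# , 1# ,
        ≈-sym (≈-trans (+-cong (zeroˡ a) (*-identityˡ b)) (+-identityˡ b)))
      d∈ : ∃₂ λ r s → d ≈ r * a + s * b
      d∈ = proj₂ (spec d) (1# , ≈-sym (*-identityˡ d))
      a′ b′ r s e : Carrier
      a′ = proj₁ d∣a
      b′ = proj₁ d∣b
      r = proj₁ d∈
      s = proj₁ (proj₂ d∈)
      e = r * a′ + s * b′
      d≈ed : d ≈ e * d
      d≈ed = ≈-trans (proj₂ (proj₂ d∈)) (≈-trans
        (+-cong (≈-trans (*-congˡ (proj₂ d∣a)) (≈-sym (*-assoc r a′ d)))
                (≈-trans (*-congˡ (proj₂ d∣b)) (≈-sym (*-assoc s b′ d))))
        (≈-sym (distribʳ d (r * a′) (s * b′))))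
      unit-cancel : ∀ {x y} → x ∣A 1# → y ≈ x * d → y ∣A d
      unit-cancel {x} {y} (u , 1≈ux) y≈xd = u , ≈-trans (≈-sym (*-identityˡ d))
        (≈-trans (*-congʳ 1≈ux) (≈-trans (*-assoc u x d) (*-congˡ (≈-sym y≈xd))))
      ∣-trans : ∀ {x y z} → x ∣A y → y ∣A z → x ∣A z
      ∣-trans {x} (u , y≈ux) (v , z≈vy) =
        v * u , ≈-trans z≈vy (≈-trans (*-congˡ y≈ux) (≈-sym (*-assoc v u x)))
      killed : (1# - e) * d ≈ 0#
      killed = ≈-trans (distribʳ d 1# (- e)) (≈-trans
        (+-cong (≈-trans (*-identityˡ d) d≈ed) (≈-sym (-‿distribˡ-* e d)))
        (-‿inverseʳ (e * d)))
      result : a ∣A b ⊎ b ∣A a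
      result with em {(M ∈I) a′} | em {(M ∈I) b′}
      -- If `a′` is a unit, `a` divides `d` and hence `b`; likewise with the roles exchanged.
      ... | no a′∉M | _ = inj₁ (∣-trans (unit-cancel (unit a′ a′∉M) (proj₂ d∣a)) d∣b)
      ... | yes _ | no b′∉M = inj₂ (∣-trans (unit-cancel (unit b′ b′∉M) (proj₂ d∣b)) d∣a)
      ... | yes a′∈M | yes b′∈M = inj₁ (∣-trans (0# , ≈-trans d≈0 (≈-sym (zeroˡ a))) d∣b)
        where
        1-e∉M : ¬ (M ∈I) (1# - e)
        1-e∉M p = M≠1 (∈-resp M
          (≈-trans (+-assoc 1# (- e) e) (≈-trans (+-congˡ (-‿inverseˡ e)) (+-identityʳ 1#)))
          (+-closed M p (+-closed M (*-closed M r a′∈M) (*-closed M s b′∈M))))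
        d≈0 : d ≈ 0#
        -- Cancelling the unit in `killed` shows that zero divides `d`.
        d≈0 = let (u , d≈u0) = unit-cancel (unit (1# - e) 1-e∉M) (≈-sym killed) in
          ≈-trans d≈u0 (zeroʳ u)

    field⇒totalDivisibility : IsField A → TotalDivisibility
    field⇒totalDivisibility (_ , inv) a b with em₀ a
    ... | yes a≈0 = inj₂ (0# , ≈-trans a≈0 (≈-sym (zeroˡ b)))
    ... | no a≉0 = let (y , ay≈1) = inv a a≉0 in inj₁ (b * y ,
      ≈-trans (≈-sym (*-identityʳ b)) (≈-trans (*-congˡ (≈-trans (≈-sym ay≈1) (*-comm a y)))
        (≈-sym (*-assoc b y a))))

    field⇒numNontrivialIdeals : IsField A → NumNontrivialIdeals A 0
    field⇒numNontrivialIdeals (_ , inv) = (λ ()) , (λ ()) , (λ ()) , λ I (I≠0 , I≠1) →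
      let (x , x∈I , x≉0) = nonzeroElement {I} I≠0
          (y , xy≈1) = inv x x≉0 in
      contradiction (∈-resp I (≈-trans (*-comm y x) xy≈1) (*-closed I y x∈I)) I≠1

    -- A nonzero non-unit would generate a nontrivial ideal. This rules out `k = 0` for the local
    -- factors, which therefore have a nontrivial ideal to choose.
    numNontrivialIdeals⇒field : ¬ 1# ≈ 0# → NumNontrivialIdeals A 0 → IsField A
    numNontrivialIdeals⇒field 1≉0 (_ , _ , _ , complete) = 1≉0 , inverse
      where
      inverse : ∀ x → ¬ x ≈ 0# → ∃ λ y → x * y ≈ 1#
      inverse x x≉0 with em {x ∣A 1#}
      ... | yes (y , 1≈yx) = y , ≈-trans (*-comm x y) (≈-sym 1≈yx)
      ... | no ¬p with complete (principal x)
                         ((λ z → x≉0 (z x (1# , ≈-sym (*-identityˡ x)))) , ¬p)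
      ... | () , _

    -- Take a nonzero element of each ideal: one divides the other, and the multiple lies in both
    -- ideals.
    totalDivisibility⇒meet≠0 : TotalDivisibility → ∀ {I J} →
      NonzeroIdeal A I → NonzeroIdeal A J → ¬ TrivialMeet I J
    totalDivisibility⇒meet≠0 div {I} {J} I≠0 J≠0 meet
      with nonzeroElement {I} I≠0 | nonzeroElement {J} J≠0
    ... | x , x∈I , x≉0 | y , y∈J , y≉0 with div x y
    ... | inj₁ (r , y≈rx) = y≉0 (meet y (∈-resp I (≈-sym y≈rx) (*-closed I r x∈I)) y∈J)
    ... | inj₂ (r , x≈ry) = x≉0 (meet x x∈I (∈-resp J (≈-sym x≈ry) (*-closed J r y∈J)))

-- Labelling the ideals of a ring and their supports

-- supp k is the set of coordinates in which ideal k is nonzero; sec chooses an ideal with each support.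
record IdealLabelling (A : CommutativeRing c ℓ) (N K : ℕ) : Set (lsuc (c ⊔ ℓ)) where
  field
    ideal           : Fin K → Ideal A
    label           : Ideal A → Fin K
    ideal-label     : ∀ I → _≐_ A I (ideal (label I))
    ideal-injective : ∀ {k l} → _≐_ A (ideal k) (ideal l) → k ≡ l
    supp            : Fin K → Vec Bool N
    disjoint⇒meet=0 : ∀ {k l} → Disjoint (supp k) (supp l) → TrivialMeet A (ideal k) (ideal l)
    meet=0⇒disjoint : ∀ {k l} → TrivialMeet A (ideal k) (ideal l) → Disjoint (supp k) (supp l)
    sec             : Vec Bool N → Fin K
    supp-sec        : ∀ v → supp (sec v) ≡ v

  -- Makes the chosen ideal of every nonempty support, the full one included, a vertex of the graph.
  ProperSection : Set (c ⊔ ℓ)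
  ProperSection = ∀ v → ProperIdeal A (ideal (sec v))

open IdealLabelling

module _ (A : CommutativeRing c ℓ) (em : ExcludedMiddle (c ⊔ ℓ)) where
  open CommutativeRing A using (_≈_; 0#; 1#)

  -- Label 0 is the zero ideal and label 1 the whole ring; t selects the ideal representing
  -- the nonempty support.
  chainLabelling : ∀ {k} → ¬ 1# ≈ 0# → TotalDivisibility A → NumNontrivialIdeals A k → Fin (suc k) →
    IdealLabelling A 1 (suc (suc k))
  chainLabelling {k} 1≉0 div (nt , nontrivial , nt-injective , complete) t = record
    { ideal = idl
    ; label = proj₁ ∘ classify
    ; ideal-label = proj₂ ∘ classify
    ; ideal-injective = λ {x} {y} → injective x y
    ; supp = supp₁
    ; disjoint⇒meet=0 = λ {x} {y} → disjoint⇒ x y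
    ; meet=0⇒disjoint = λ {x} {y} → ⇒disjoint x y
    ; sec = sec₁
    ; supp-sec = λ { (true ∷ []) → refl ; (false ∷ []) → refl }
    }
    where
    idl : Fin (suc (suc k)) → Ideal A
    idl zero = zeroIdeal A
    idl (suc zero) = unitIdeal A
    idl (suc (suc i)) = nt i

    classify : ∀ I → ∃ λ l → _≐_ A I (idl l)
    classify I with em {∀ x → (I ∈I) x → x ≈ 0#} | em {(I ∈I) 1#}
    ... | yes I=0 | _ = zero , (λ x → lift ∘ I=0 x) ,
      (λ x p → ∈-resp I (CommutativeRing.sym A (lower p)) (0∈ I))
    ... | no _ | yes 1∈I = suc zero , _ , λ x _ → 1∈⇒∈ A I 1∈I x
    ... | no I≠0 | no 1∉I = let (i , e) = complete I (I≠0 , 1∉I) in suc (suc i) , e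

    nonzero : ∀ l → NonzeroIdeal A (idl (suc l))
    nonzero zero z = 1≉0 (z 1# _)
    nonzero (suc i) = proj₁ (nontrivial i)

    injective : ∀ x y → _≐_ A (idl x) (idl y) → x ≡ y
    injective zero zero _ = refl
    injective zero (suc y) (_ , g) = contradiction (λ x → lower ∘ g x) (nonzero y)
    injective (suc x) zero (f , _) = contradiction (λ y → lower ∘ f y) (nonzero x)
    injective (suc zero) (suc zero) _ = refl
    injective (suc zero) (suc (suc j)) (f , _) = contradiction (f 1# _) (proj₂ (nontrivial j))
    injective (suc (suc i)) (suc zero) (_ , g) = contradiction (g 1# _) (proj₂ (nontrivial i))
    injective (suc (suc i)) (suc (suc j)) e = cong (λ l → suc (suc l)) (nt-injective i j e)

    supp₁ : Fin (suc (suc k)) → Vec Bool 1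
    supp₁ zero = false ∷ []
    supp₁ (suc _) = true ∷ []

    disjoint⇒ : ∀ x y → Disjoint (supp₁ x) (supp₁ y) → TrivialMeet A (idl x) (idl y)
    disjoint⇒ zero _ _ _ p _ = lower p
    disjoint⇒ (suc _) zero _ _ _ q = lower q
    disjoint⇒ (suc _) (suc _) (() ∷ _)

    ⇒disjoint : ∀ x y → TrivialMeet A (idl x) (idl y) → Disjoint (supp₁ x) (supp₁ y)
    ⇒disjoint zero zero _ = refl ∷ []
    ⇒disjoint zero (suc _) _ = refl ∷ []
    ⇒disjoint (suc _) zero _ = refl ∷ []
    ⇒disjoint (suc x) (suc y) meet = contradiction meet
      (totalDivisibility⇒meet≠0 A em div {idl (suc x)} {idl (suc y)} (nonzero x) (nonzero y))

    sec₁ : Vec Bool 1 → Fin (suc (suc k))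
    sec₁ (true ∷ []) = suc t
    sec₁ (false ∷ []) = zero

  -- The nonempty support can only be represented by the whole field, so this section is not proper;
  -- properness has to come from the local factors.
  fieldLabelling : IsField A → IdealLabelling A 1 2
  fieldLabelling fld = chainLabelling (proj₁ fld) (field⇒totalDivisibility A em fld)
    (field⇒numNontrivialIdeals A em fld) zero

  localLabelling : ∀ {k} → IsLocal A → IsPrincipalIdealRing A → HasFinitelyManyIdeals A →
    ¬ IsField A → NumNontrivialIdeals A k → Σ (IdealLabelling A 1 (suc (suc k))) ProperSection
  localLabelling {zero} loc _ _ ¬field num =
    contradiction (numNontrivialIdeals⇒field A em (local⇒1≉0 A loc) num) ¬field
  localLabelling {suc k} loc pir fin _ num =
    -- `suc zero` selects label 2, the first nontrivial ideal, so the section avoids the whole ring.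
    chainLabelling 1≉0 (local⇒totalDivisibility A em loc pir fin) num (suc zero) ,
    λ { (true ∷ []) → proj₂ (proj₁ (proj₂ num) zero) ; (false ∷ []) → 1≉0 ∘ lower }
    where
    1≉0 : ¬ 1# ≈ 0#
    1≉0 = local⇒1≉0 A loc

-- Ideals and labellings of products

open Data.Nat using (_+_; _*_)

module _ {A B : CommutativeRing c ℓ} where
  private
    module A = CommutativeRing A
    module B = CommutativeRing B

  _×I_ : Ideal A → Ideal B → Ideal (A ×R B)
  I ×I J = record
    { _∈I = λ (x , y) → (I ∈I) x × (J ∈I) y
    ; ∈-resp = λ (e , f) (p , q) → ∈-resp I e p , ∈-resp J f q
    ; 0∈ = 0∈ I , 0∈ J
    ; +-closed = λ (p , q) (p′ , q′) → +-closed I p p′ , +-closed J q q′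
    ; *-closed = λ (r , s) (p , q) → *-closed I r p , *-closed J s q
    }

  leftIdeal : Ideal (A ×R B) → Ideal A
  leftIdeal I = record
    { _∈I = λ x → (I ∈I) (x , B.0#)
    ; ∈-resp = λ e → ∈-resp I (e , B.refl)
    ; 0∈ = 0∈ I
    ; +-closed = λ p q → ∈-resp I (A.refl , B.+-identityˡ B.0#) (+-closed I p q)
    ; *-closed = λ r p → ∈-resp I (A.refl , B.zeroʳ B.0#) (*-closed I (r , B.0#) p)
    }

  rightIdeal : Ideal (A ×R B) → Ideal B
  rightIdeal I = record
    { _∈I = λ y → (I ∈I) (A.0# , y)
    ; ∈-resp = λ e → ∈-resp I (A.refl , e)
    ; 0∈ = 0∈ I
    ; +-closed = λ p q → ∈-resp I (A.+-identityˡ A.0# , B.refl) (+-closed I p q)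
    ; *-closed = λ r p → ∈-resp I (A.zeroʳ A.0# , B.refl) (*-closed I (A.0# , r) p)
    }

  -- Multiplying by the idempotents (1, 0) and (0, 1) splits an element of `I` into its two parts,
  -- and adding them recovers it.
  ideal≐left×right : ∀ I → _≐_ (A ×R B) I (leftIdeal I ×I rightIdeal I)
  ideal≐left×right I =
    (λ (x , y) p →
      ∈-resp I (A.*-identityˡ x , B.zeroˡ y) (*-closed I (A.1# , B.0#) p) ,
      ∈-resp I (A.zeroˡ x , B.*-identityˡ y) (*-closed I (A.0# , B.1#) p)) ,
    (λ (x , y) (p , q) → ∈-resp I (A.+-identityʳ x , B.+-identityˡ y) (+-closed I p q))

  ×I-cong : ∀ {I I′ J J′} → _≐_ A I I′ → _≐_ B J J′ → _≐_ (A ×R B) (I ×I J) (I′ ×I J′)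
  ×I-cong (f , g) (h , k) =
    (λ (x , y) (p , q) → f x p , h y q) , (λ (x , y) (p , q) → g x p , k y q)

  ×I-injective : ∀ {I I′ J J′} → _≐_ (A ×R B) (I ×I J) (I′ ×I J′) → _≐_ A I I′ × _≐_ B J J′
  ×I-injective {I} {I′} {J} {J′} (f , g) =
    ((λ x p → proj₁ (f (x , B.0#) (p , 0∈ J))) , (λ x p → proj₁ (g (x , B.0#) (p , 0∈ J′)))) ,
    ((λ y q → proj₂ (f (A.0# , y) (0∈ I , q))) , (λ y q → proj₂ (g (A.0# , y) (0∈ I′ , q))))

  module _ {N N′ K K′ : ℕ} (L : IdealLabelling A N K) (L′ : IdealLabelling B N′ K′) where
    private
      split : Fin (K * K′) → Fin K × Fin K′
      split = remQuot K′

      idl : Fin K × Fin K′ → Ideal (A ×R B)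
      idl (i , j) = ideal L i ×I ideal L′ j

      support : Fin K × Fin K′ → Vec Bool (N + N′)
      support (i , j) = supp L i ++ supp L′ j

    -- Pairs of labels are coded by `combine`, and supports are concatenated. A meet of product
    -- ideals vanishes exactly when both components do, as elements with one zero coordinate show.
    ×-labelling : IdealLabelling (A ×R B) (N + N′) (K * K′)
    ×-labelling = record
      { ideal = idl ∘ split
      ; label = λ I → combine (label L (leftIdeal I)) (label L′ (rightIdeal I))
      ; ideal-label = λ I → subst (λ ij → _≐_ (A ×R B) I (idl ij)) (sym (remQuot-combine _ _))
          (≐-trans (A ×R B) {I} {leftIdeal I ×I rightIdeal I} {idl (_ , _)} (ideal≐left×right I)
            (×I-cong {leftIdeal I} {ideal L _} {rightIdeal I} {ideal L′ _}
              (ideal-label L (leftIdeal I)) (ideal-label L′ (rightIdeal I))))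
      ; ideal-injective = λ {k} {l} e →
          let (i , j) = split k
              (i′ , j′) = split l
              (p , q) = ×I-injective {ideal L i} {ideal L i′} {ideal L′ j} {ideal L′ j′} e in
          trans (sym (combine-remQuot {K} K′ k))
            (trans (cong₂ combine (ideal-injective L p) (ideal-injective L′ q))
              (combine-remQuot {K} K′ l))
      ; supp = support ∘ split
      ; disjoint⇒meet=0 = λ {k} {l} d (x , y) (p , q) (p′ , q′) →
          let (i , j) = split k
              (i′ , j′) = split l
              (d₁ , d₂) = Pointwise.++⁻ (supp L i) (supp L i′) d in
          disjoint⇒meet=0 L {i} {i′} d₁ x p p′ , disjoint⇒meet=0 L′ {j} {j′} d₂ y q q′
      ; meet=0⇒disjoint = λ {k} {l} meet →
          let (i , j) = split k
              (i′ , j′) = split l in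
          Pointwise.++⁺
            (meet=0⇒disjoint L {i} {i′} λ x p p′ →
              proj₁ (meet (x , B.0#) (p , 0∈ (ideal L′ j)) (p′ , 0∈ (ideal L′ j′))))
            (meet=0⇒disjoint L′ {j} {j′} λ y q q′ →
              proj₂ (meet (A.0# , y) (0∈ (ideal L i) , q) (0∈ (ideal L i′) , q′)))
      ; sec = λ v → combine (sec L (take N v)) (sec L′ (drop N v))
      ; supp-sec = λ v → trans (cong support (remQuot-combine _ _))
          (trans (cong₂ _++_ (supp-sec L (take N v)) (supp-sec L′ (drop N v))) (take++drop≡id N v))
      }

    -- An ideal containing 1 contains 1 in its left component. The right factor may be a product of
    -- fields, whose section takes the whole ring as a value.
    ×-properSection : ProperSection L → ProperSection ×-labelling
    ×-properSection proper v 1∈ = proper (take N v) (proj₁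
      (subst (λ ij → (idl ij ∈I) (A.1# , B.1#)) (remQuot-combine (sec L (take N v)) _) 1∈))

-- Recurses exactly as `ΠRing` does, without a final factor 1, so that label counts match
-- definitionally.
nonemptyProduct : (k : ℕ) → (Fin (suc k) → ℕ) → ℕ
nonemptyProduct zero    f = f zero
nonemptyProduct (suc k) f = f zero * nonemptyProduct k (f ∘ suc)

Π-labelling : ∀ k (As : Fin (suc k) → CommutativeRing c ℓ) (Ks : Fin (suc k) → ℕ) →
  (∀ i → IdealLabelling (As i) 1 (Ks i)) →
  IdealLabelling (ΠRing k As) (suc k) (nonemptyProduct k Ks)
Π-labelling zero    As Ks Ls = Ls zero
Π-labelling (suc k) As Ks Ls = ×-labelling (Ls zero) (Π-labelling k (As ∘ suc) (Ks ∘ suc) (Ls ∘ suc))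

Π-properSection : ∀ k (As : Fin (suc k) → CommutativeRing c ℓ) (Ks : Fin (suc k) → ℕ) →
  (Ls : ∀ i → IdealLabelling (As i) 1 (Ks i)) → ProperSection (Ls zero) →
  ProperSection (Π-labelling k As Ks Ls)
Π-properSection zero    As Ks Ls proper = proper
Π-properSection (suc k) As Ks Ls proper =
  ×-properSection (Ls zero) (Π-labelling k (As ∘ suc) (Ks ∘ suc) (Ls ∘ suc)) proper

-- Transport along a ring isomorphism

module _ {A B : CommutativeRing c ℓ} (A≅B : A ≅R B) where
  private
    module A = CommutativeRing A
    module B = CommutativeRing B
    f = proj₁ A≅B
    open RingMorphisms.IsRingIsomorphism (proj₂ A≅B)

    f⁻¹ : ∀ y → ∃ λ x → f x B.≈ y
    f⁻¹ y = let (x , p) = surjective y in x , p A.refl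

  preimage : Ideal B → Ideal A
  preimage I = record
    { _∈I = λ x → (I ∈I) (f x)
    ; ∈-resp = λ e → ∈-resp I (⟦⟧-cong e)
    ; 0∈ = ∈-resp I (B.sym 0#-homo) (0∈ I)
    ; +-closed = λ p q → ∈-resp I (B.sym (+-homo _ _)) (+-closed I p q)
    ; *-closed = λ r p → ∈-resp I (B.sym (*-homo _ _)) (*-closed I (f r) p)
    }

  image : Ideal A → Ideal B
  image I = record
    { _∈I = λ y → ∃ λ x → (I ∈I) x × f x B.≈ y
    ; ∈-resp = λ { e (x , p , fx≈y) → x , p , B.trans fx≈y e }
    ; 0∈ = A.0# , 0∈ I , 0#-homo
    ; +-closed = λ { (x , p , e) (x′ , p′ , e′) →
        x A.+ x′ , +-closed I p p′ , B.trans (+-homo x x′) (B.+-cong e e′) }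
    ; *-closed = λ { r (x , p , e) → let (s , fs≈r) = f⁻¹ r in
        s A.* x , *-closed I s p , B.trans (*-homo s x) (B.*-cong fs≈r e) }
    }

  preimage-injective : ∀ {I J} → _≐_ A (preimage I) (preimage J) → _≐_ B I J
  preimage-injective {I} {J} (g , h) =
    (λ y p → let (x , e) = f⁻¹ y in ∈-resp J e (g x (∈-resp I (B.sym e) p))) ,
    (λ y p → let (x , e) = f⁻¹ y in ∈-resp I e (h x (∈-resp J (B.sym e) p)))

  ≅-labelling : ∀ {N K} → IdealLabelling B N K → IdealLabelling A N K
  ≅-labelling L = record
    { ideal = preimage ∘ ideal L
    ; label = label L ∘ image
    ; ideal-label = λ I → let (g , h) = ideal-label L (image I) in
        (λ x p → g (f x) (x , p , B.refl)) ,
        (λ x p → let (x′ , x′∈I , e) = h (f x) p in ∈-resp I (injective e) x′∈I)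
    ; ideal-injective = λ {k} {l} → ideal-injective L ∘ preimage-injective {ideal L k} {ideal L l}
    ; supp = supp L
    ; disjoint⇒meet=0 = λ d x p q →
        injective (B.trans (disjoint⇒meet=0 L d (f x) p q) (B.sym 0#-homo))
    ; meet=0⇒disjoint = λ {k} {l} meet → meet=0⇒disjoint L λ y p q → let (x , e) = f⁻¹ y in
        B.trans (B.sym e) (B.trans (⟦⟧-cong (meet x (∈-resp (ideal L k) (B.sym e) p)
          (∈-resp (ideal L l) (B.sym e) q))) 0#-homo)
    ; sec = sec L
    ; supp-sec = supp-sec L
    }

  ≅-properSection : ∀ {N K} (L : IdealLabelling B N K) → ProperSection L →
    ProperSection (≅-labelling L)
  ≅-properSection L proper v 1∈ = proper v (∈-resp (ideal L (sec L v)) 1#-homo 1∈)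

-- Combinatorics of supports

disjoint-sym : ∀ {n} {v w : Vec Bool n} → Disjoint v w → Disjoint w v
disjoint-sym = Pointwise.sym λ {a} {b} e → trans (∧-comm b a) e

disjoint-self : ∀ {n} {v : Vec Bool n} → Disjoint v v → ∀ w → Disjoint v w
disjoint-self [] [] = []
disjoint-self {v = false ∷ _} (_ ∷ d) (_ ∷ w) = refl ∷ disjoint-self d w

disjoint-full : ∀ {n} {v : Vec Bool n} → Disjoint v (replicate n true) → Disjoint v v
disjoint-full {v = []} [] = []
disjoint-full {v = false ∷ _} (_ ∷ d) = refl ∷ disjoint-full d

disjoint? : ∀ {n} (v w : Vec Bool n) → Dec (Disjoint v w)
disjoint? = Pointwise.decidable λ a b → (a ∧ b) ≟ᵇ false

disjoint-empty : ∀ {n} (v : Vec Bool n) → Disjoint (replicate n false) v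
disjoint-empty [] = []
disjoint-empty (_ ∷ v) = refl ∷ disjoint-empty v

disjoint-not : ∀ {n} (v : Vec Bool n) → Disjoint v (Vec.map not v)
disjoint-not [] = []
disjoint-not (a ∷ v) = ∧-inverseʳ a ∷ disjoint-not v

-- `e` is the singleton of the first coordinate where the vectors differ; the disjunction records
-- which of them contains it.
separate : ∀ {n} (v w : Vec Bool n) → v ≢ w →
  ∃ λ e → (¬ Disjoint e v × Disjoint e w) ⊎ (Disjoint e v × ¬ Disjoint e w)
separate [] [] v≢w = contradiction refl v≢w
separate {suc n} (true ∷ v) (false ∷ w) _ =
  true ∷ replicate n false , inj₁ ((λ { (() ∷ _) }) , refl ∷ disjoint-empty w)
separate {suc n} (false ∷ v) (true ∷ w) _ =
  true ∷ replicate n false , inj₂ (refl ∷ disjoint-empty v , λ { (() ∷ _) })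
separate (true ∷ v) (true ∷ w) v≢w with separate v w (v≢w ∘ cong (true ∷_))
... | e , inj₁ (p , q) = false ∷ e , inj₁ ((λ { (_ ∷ d) → p d }) , refl ∷ q)
... | e , inj₂ (p , q) = false ∷ e , inj₂ (refl ∷ p , λ { (_ ∷ d) → q d })
separate (false ∷ v) (false ∷ w) v≢w with separate v w (v≢w ∘ cong (false ∷_))
... | e , inj₁ (p , q) = false ∷ e , inj₁ ((λ { (_ ∷ d) → p d }) , refl ∷ q)
... | e , inj₂ (p , q) = false ∷ e , inj₂ (refl ∷ p , λ { (_ ∷ d) → q d })

map-not-injective : ∀ {n} (v w : Vec Bool n) → Vec.map not v ≡ Vec.map not w → v ≡ w
map-not-injective [] [] _ = refl
map-not-injective (a ∷ v) (b ∷ w) e = cong₂ _∷_ (not-injective (∷-injectiveˡ e))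
  (map-not-injective v w (∷-injectiveʳ e))

-- Picks the member containing the first point from each pair of complementary subsets.
normalise : ∀ {n} → Vec Bool (suc n) → Vec Bool n
normalise (true ∷ v) = v
normalise (false ∷ v) = Vec.map not v

-- The only other vector with the same image is the complement, which is disjoint.
normalise-collision : ∀ {n} (v w : Vec Bool (suc n)) → normalise v ≡ normalise w → v ≡ w ⊎ Disjoint v w
normalise-collision (true ∷ v) (true ∷ w) e = inj₁ (cong (true ∷_) e)
normalise-collision (true ∷ v) (false ∷ w) refl = inj₂ (refl ∷ disjoint-sym (disjoint-not w))
normalise-collision (false ∷ v) (true ∷ w) refl = inj₂ (refl ∷ disjoint-not v)
normalise-collision (false ∷ v) (false ∷ w) e = inj₁ (cong (false ∷_) (map-not-injective v w e))

boolVecs : ∀ n → List (Vec Bool n)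
boolVecs zero = [] ∷ []
boolVecs (suc n) = map (true ∷_) (boolVecs n) List.++ map (false ∷_) (boolVecs n)

∈-boolVecs : ∀ {n} (v : Vec Bool n) → v ∈ boolVecs n
∈-boolVecs [] = here refl
∈-boolVecs (true ∷ v) = ∈-++⁺ˡ (∈-map⁺ (true ∷_) (∈-boolVecs v))
∈-boolVecs {suc n} (false ∷ v) = ∈-++⁺ʳ (map (true ∷_) (boolVecs n)) (∈-map⁺ (false ∷_) (∈-boolVecs v))

boolVecs-unique : ∀ n → Unique (boolVecs n)
boolVecs-unique zero = [] ∷ []
boolVecs-unique (suc n) = Unique.++⁺ (Unique.map⁺ ∷-injectiveʳ (boolVecs-unique n))
  (Unique.map⁺ ∷-injectiveʳ (boolVecs-unique n)) λ (p , q) → apart p q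
  where
  apart : ∀ {v} → v ∈ map (true ∷_) (boolVecs n) → v ∈ map (false ∷_) (boolVecs n) → ⊥
  apart p q with ∈-map⁻ (true ∷_) p | ∈-map⁻ (false ∷_) q
  ... | _ , _ , refl | _ , _ , ()

length-boolVecs : ∀ n → length (boolVecs n) ≡ 2 ^ n
length-boolVecs zero = refl
length-boolVecs (suc n) = trans (length-++ (map (true ∷_) (boolVecs n))) (cong₂ _+_
  (trans (length-map _ (boolVecs n)) (length-boolVecs n))
  (trans (trans (length-map _ (boolVecs n)) (length-boolVecs n)) (sym (ℕ.+-identityʳ _))))

-- Counting with duplicate-free lists

module _ {a : Level} {X : Set a} where

  -- Pigeonhole by deleting the head `x` from `ys`: the tail avoids `x`, so it stays included in
  -- what is left.
  unique-⊆⇒length≤ : ∀ {xs ys : List X} → Unique xs → xs ⊆ ys → length xs ≤ length ys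
  unique-⊆⇒length≤ [] _ = z≤n
  unique-⊆⇒length≤ {x ∷ xs} (x∉xs ∷ xs!) sub with ∈-∃++ (sub (here refl))
  ... | as , bs , refl = subst (suc (length xs) ≤_) (sym |as++x∷bs|) (s≤s (unique-⊆⇒length≤ xs! sub′))
    where
    |as++x∷bs| : length (as List.++ x ∷ bs) ≡ suc (length (as List.++ bs))
    |as++x∷bs| = trans (length-++ as) (trans (+-suc _ _) (cong suc (sym (length-++ as))))
    sub′ : xs ⊆ as List.++ bs
    sub′ z∈xs with ∈-++⁻ as (sub (there z∈xs))
    ... | inj₁ z∈as = ∈-++⁺ˡ z∈as
    ... | inj₂ (here refl) = contradiction refl (All.lookup x∉xs z∈xs)
    ... | inj₂ (there z∈bs) = ∈-++⁺ʳ as z∈bs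

  -- For maps that separate only the elements satisfying `P`, with `R` as the notion of being
  -- distinct in the target.
  allPairs-map⁺ : ∀ {b p r} {Y : Set b} {P : X → Set p} {R : Y → Y → Set r} {f : X → Y} {xs} →
    (∀ {x y} → P x → P y → x ≢ y → R (f x) (f y)) → All P xs → Unique xs → AllPairs R (map f xs)
  allPairs-map⁺ h [] [] = []
  allPairs-map⁺ h (p ∷ ps) (x∉xs ∷ xs!) =
    All.map⁺ (All.zipWith (λ (q , x≢y) → h p q x≢y) (ps , x∉xs)) ∷ allPairs-map⁺ h ps xs!

-- Distances and strong resolution in the graph, read off labels and supports

module _ {A : CommutativeRing c ℓ} {N K : ℕ}
         (L : IdealLabelling A (suc N) K) (proper : ProperSection L) where
  open CommutativeRing A using (1#)

  private
    lab : Vertex A → Fin K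
    lab u = label L (proj₁ u)

    S : Vertex A → Vec Bool (suc N)
    S u = supp L (lab u)

  label-cong : ∀ I J → _≐_ A I J → label L I ≡ label L J
  label-cong I J e = ideal-injective L (≐-trans A {ideal L (label L I)} {I} {ideal L (label L J)}
    (≐-sym A {I} {ideal L (label L I)} (ideal-label L I))
    (≐-trans A {I} {J} {ideal L (label L J)} e (ideal-label L J)))

  label-injective : ∀ I J → label L I ≡ label L J → _≐_ A I J
  label-injective I J e = ≐-trans A {I} {ideal L (label L I)} {J} (ideal-label L I)
    (subst (λ l → _≐_ A (ideal L l) J) (sym e)
      (≐-sym A {J} {ideal L (label L J)} (ideal-label L J)))

  label-ideal : ∀ l → label L (ideal L l) ≡ l
  label-ideal l = sym (ideal-injective L (ideal-label L (ideal L l)))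

  disjoint⇒trivialMeet : ∀ I J → Disjoint (supp L (label L I)) (supp L (label L J)) → TrivialMeet A I J
  disjoint⇒trivialMeet I J d x p q =
    disjoint⇒meet=0 L d x (proj₁ (ideal-label L I) x p) (proj₁ (ideal-label L J) x q)

  trivialMeet⇒disjoint : ∀ I J → TrivialMeet A I J → Disjoint (supp L (label L I)) (supp L (label L J))
  trivialMeet⇒disjoint I J meet = meet=0⇒disjoint L λ x p q →
    meet x (proj₂ (ideal-label L I) x p) (proj₂ (ideal-label L J) x q)

  supp≠∅ : ∀ (u : Vertex A) → ¬ Disjoint (S u) (S u)
  supp≠∅ (I , I≠0 , _) d = I≠0 λ x p → disjoint⇒trivialMeet I I d x p p

  sectionVertex : ∀ v → ¬ Disjoint v v → Vertex A
  sectionVertex v v≠∅ = ideal L (sec L v) , (λ I=0 → v≠∅ (subst (λ w → Disjoint w w) (supp-sec L v)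
    (meet=0⇒disjoint L λ x p _ → I=0 x p))) , proper v

  private
    -- The hub of the graph: its support is everything, so it meets every vertex, and `proper` keeps
    -- it a proper ideal.
    full : Vertex A
    full = sectionVertex (replicate (suc N) true) λ { (() ∷ _) }

    S-full : S full ≡ replicate (suc N) true
    S-full = trans (cong (supp L) (label-ideal _)) (supp-sec L _)

    meets-full : ∀ u → ¬ Disjoint (S u) (S full)
    meets-full u d = supp≠∅ u (disjoint-full (subst (Disjoint (S u)) S-full d))

  adj⇒ : ∀ u v → Adj A u v → lab u ≢ lab v × ¬ Disjoint (S u) (S v)
  adj⇒ (I , _) (J , _) (u≠v , meet≠0) = u≠v ∘ label-injective I J , meet≠0 ∘ disjoint⇒trivialMeet I J

  ⇒adj : ∀ u v → lab u ≢ lab v → ¬ Disjoint (S u) (S v) → Adj A u v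
  ⇒adj (I , _) (J , _) u≢v meets = u≢v ∘ label-cong I J , meets ∘ trivialMeet⇒disjoint I J

  -- A combinatorial model of `Dist`: case analysis on it replaces reasoning about walks.
  data Distance (k l : Fin K) : ℕ → Set where
    equal : k ≡ l → Distance k l 0
    near  : k ≢ l → ¬ Disjoint (supp L k) (supp L l) → Distance k l 1
    far   : k ≢ l → Disjoint (supp L k) (supp L l) → Distance k l 2

  distance : ∀ k l → ∃ (Distance k l)
  distance k l with k ≟ l | disjoint? (supp L k) (supp L l)
  ... | yes k≡l | _ = 0 , equal k≡l
  ... | no k≢l | no meets = 1 , near k≢l meets
  ... | no k≢l | yes disj = 2 , far k≢l disj

  distance⇒dist : ∀ {k} u v → Distance (lab u) (lab v) k → Dist A u v k
  distance⇒dist u v (equal e) = here (label-injective (proj₁ u) (proj₁ v) e) , λ _ _ → z≤n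
  distance⇒dist u v (near u≢v meets) =
    step {w = v} (⇒adj u v u≢v meets) (here (≐-refl A {proj₁ v})) ,
    λ { zero (here e) → contradiction (label-cong (proj₁ u) (proj₁ v) e) u≢v
      ; (suc _) _ → s≤s z≤n }
  distance⇒dist u v (far u≢v disj) =
    step {w = full} (⇒adj u full u≢full (meets-full u))
      (step {w = v} (⇒adj full v (≢-sym v≢full) (meets-full v ∘ disjoint-sym)) (here (≐-refl A {proj₁ v}))) ,
    minimal
    where
    -- Neither endpoint is `full`, since `full` meets the other endpoint while `u` and `v` are
    -- disjoint.
    u≢full : lab u ≢ lab full
    u≢full e = meets-full v (disjoint-sym (subst (λ l → Disjoint (supp L l) (S v)) e disj))
    v≢full : lab v ≢ lab full
    v≢full e = meets-full u (subst (λ l → Disjoint (S u) (supp L l)) e disj)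
    minimal : ∀ j → Walk A u v j → 2 ≤ j
    minimal zero (here e) = contradiction (label-cong (proj₁ u) (proj₁ v) e) u≢v
    minimal (suc zero) (step {w = w} adj (here e)) = contradiction
      (subst (λ l → Disjoint (S u) (supp L l)) (sym (label-cong (proj₁ w) (proj₁ v) e)) disj)
      (proj₂ (adj⇒ u w adj))
    minimal (suc (suc _)) _ = s≤s (s≤s z≤n)

  -- Minimal walk lengths are unique, so the given one is the computed one.
  dist⇒distance : ∀ {k} u v → Dist A u v k → Distance (lab u) (lab v) k
  dist⇒distance {k} u v (walk , minimal) =
    let (j , d) = distance (lab u) (lab v)
        (walk′ , minimal′) = distance⇒dist u v d in
    subst (Distance (lab u) (lab v)) (≤-antisym (minimal′ k walk) (minimal j walk′)) d

  -- Distinct vertices with equal or disjoint supports are mutually maximally distant, so a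
  -- third vertex never resolves them.
  beyond⇒endpoint : ∀ {w u v a b e} → u ≢ v → supp L v ≡ supp L u ⊎ Disjoint (supp L v) (supp L u) →
    Distance w u a → Distance w v b → Distance v u e → a ≡ b + e → w ≡ u ⊎ w ≡ v
  beyond⇒endpoint _ _ (equal w≡u) _ _ _ = inj₁ w≡u
  beyond⇒endpoint _ _ _ (equal w≡v) _ _ = inj₂ w≡v
  beyond⇒endpoint u≢v _ _ _ (equal v≡u) _ = contradiction (sym v≡u) u≢v
  -- Now `b` and `e` are at least 1 and `a` is at most 2, so only `2 ≡ 1 + 1` survives.
  beyond⇒endpoint {w} _ (inj₁ same) (far _ disj) (near _ meets) (near _ _) _ =
    contradiction (subst (Disjoint (supp L w)) (sym same) disj) meets
  beyond⇒endpoint _ (inj₂ disj) (far _ _) (near _ _) (near _ meets) _ = contradiction disj meets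

  resolver∈pair : ∀ w u v → lab u ≢ lab v → S u ≡ S v ⊎ Disjoint (S u) (S v) →
    StronglyResolves A w u v → lab w ≡ lab u ⊎ lab w ≡ lab v
  resolver∈pair w u v u≢v mmd (inj₁ (_ , _ , _ , dwu , dwv , dvu , eq)) =
    beyond⇒endpoint u≢v (Sum.map sym disjoint-sym mmd)
      (dist⇒distance w u dwu) (dist⇒distance w v dwv) (dist⇒distance v u dvu) eq
  resolver∈pair w u v u≢v mmd (inj₂ (_ , _ , _ , dwv , dwu , duv , eq)) =
    Sum.swap (beyond⇒endpoint (≢-sym u≢v) mmd
      (dist⇒distance w v dwv) (dist⇒distance w u dwu) (dist⇒distance u v duv) eq)

  self-resolves : ∀ w u v → lab w ≡ lab u → StronglyResolves A w u v
  self-resolves w u v w≡u =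
    let (k , d) = distance (lab u) (lab v) in
    inj₂ (k , 0 , k , distance⇒dist w v (subst (λ l → Distance l (lab v) k) (sym w≡u) d) ,
      distance⇒dist w u (equal w≡u) , distance⇒dist u v d , refl)

  -- Here `u` is the midpoint of a shortest path from `w` to `v`.
  between-resolves : ∀ w u v → lab w ≢ lab u → ¬ Disjoint (S w) (S u) → Disjoint (S w) (S v) →
    lab u ≢ lab v → ¬ Disjoint (S u) (S v) → StronglyResolves A w u v
  between-resolves w u v w≢u w∩u w⊥v u≢v u∩v =
    inj₂ (2 , 1 , 1 , distance⇒dist w v (far w≢v w⊥v) , distance⇒dist w u (near w≢u w∩u) ,
      distance⇒dist u v (near u≢v u∩v) , refl)
    where
    -- Otherwise the support of `v` would be disjoint from itself, hence empty, yet it meets that of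
    -- `u`.
    w≢v : lab w ≢ lab v
    w≢v e = u∩v (disjoint-sym (subst (λ l → Disjoint (supp L l) (S u)) e
      (disjoint-self (subst (λ l → Disjoint (S w) (supp L l)) (sym e) w⊥v) (S u))))

  -- Vertices as labels, and counting the labels outside a list

  private
    bot top : Fin K
    bot = label L (zeroIdeal A)
    top = label L (unitIdeal A)

    VertexLabel : Fin K → Set
    VertexLabel l = l ≢ bot × l ≢ top

  lab-vertexLabel : ∀ u → VertexLabel (lab u)
  lab-vertexLabel (I , I≠0 , I≠1) =
    (λ e → I≠0 λ x p → lower (proj₁ (label-injective I (zeroIdeal A) e) x p)) ,
    (λ e → I≠1 (proj₂ (label-injective I (unitIdeal A) e) 1# _))

  vertexAt : ∀ l → VertexLabel l → Vertex A
  vertexAt l (l≢bot , l≢top) = ideal L l ,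
    (λ I=0 → l≢bot (trans (sym (label-ideal l)) (label-cong (ideal L l) (zeroIdeal A)
      ((λ x → lift ∘ I=0 x) , λ x p → ∈-resp (ideal L l) (CommutativeRing.sym A (lower p)) (0∈ (ideal L l)))))) ,
    (λ 1∈I → l≢top (trans (sym (label-ideal l)) (label-cong (ideal L l) (unitIdeal A)
      (_ , λ x _ → 1∈⇒∈ A (ideal L l) 1∈I x))))

  -- The two labels that are not vertices are sent to the junk value `full`.
  vertex : Fin K → Vertex A
  vertex l with ¬? (l ≟ bot) ×-dec ¬? (l ≟ top)
  ... | yes p = vertexAt l p
  ... | no _ = full

  lab-vertex : ∀ {l} → VertexLabel l → lab (vertex l) ≡ l
  lab-vertex {l} p with ¬? (l ≟ bot) ×-dec ¬? (l ≟ top)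
  ... | yes _ = label-ideal l
  ... | no ¬p = contradiction p ¬p

  private
    open DecMembership (_≟_ {K}) using (_∈?_; _∉?_)

    others : List (Fin K) → List (Fin K)
    others X = filter (_∉? X) (allFin K)

    ∈-others : ∀ {X l} → l ∉ X → l ∈ others X
    ∈-others {X} {l} = ∈-filter⁺ (_∉? X) (∈-allFin l)

    others-∉ : ∀ X → All (_∉ X) (others X)
    others-∉ X = All.all-filter (_∉? X) (allFin K)

    others-unique : ∀ X → Unique (others X)
    others-unique X = Unique.filter⁺ (_∉? X) (Unique.allFin⁺ K)

    -- An inequality because `X` may repeat labels; for duplicate-free `X`, `≤K` turns it into an
    -- equality.
    K≤ : ∀ X → K ≤ length X + length (others X)
    K≤ X = subst₂ _≤_ (length-tabulate id) (length-++ X)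
      (unique-⊆⇒length≤ (Unique.allFin⁺ K) cover)
      where
      cover : allFin K ⊆ X List.++ others X
      cover {l} _ with l ∈? X
      ... | yes l∈X = ∈-++⁺ˡ l∈X
      ... | no l∉X = ∈-++⁺ʳ X (∈-others l∉X)

    ≤K : ∀ {X} → Unique X → length X + length (others X) ≤ K
    ≤K {X} X! = subst₂ _≤_ (length-++ X) (length-tabulate id) (unique-⊆⇒length≤
      (Unique.++⁺ X! (others-unique X) (λ (p , q) → All.lookup (others-∉ X) q p)) (λ {l} _ → ∈-allFin l))

    ∉⇒vertexLabel : ∀ {l X} → l ∉ bot ∷ top ∷ X → VertexLabel l
    ∉⇒vertexLabel l∉ = l∉ ∘ here , l∉ ∘ there ∘ here

  -- Lower bound for strong resolving sets

  module _ (W : List (Vertex A)) (resolving : IsStrongResolvingSet A W) where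
    private
      -- With the two non-vertices put into `X`, every label in `C` is a vertex outside `W`.
      X C : List (Fin K)
      X = bot ∷ top ∷ map lab W
      C = others X

    -- A collision would make the supports equal or disjoint; the member of `W` resolving the pair
    -- would then be one of the two, but both lie outside `W`.
    unresolved-collision : ∀ {k l} → k ∉ X → l ∉ X → k ≢ l →
      normalise (supp L k) ≢ normalise (supp L l)
    unresolved-collision {k} {l} k∉ l∉ k≢l e =
      let (w , w∈W , res) = find (resolving (vertex k) (vertex l)
            (u≢v ∘ label-cong (proj₁ (vertex k)) (proj₁ (vertex l)))) in
      [ (λ w≡u → k∉ (there (there (subst (_∈ map lab W) (trans w≡u (lab-vertex pk)) (∈-map⁺ lab w∈W)))))
      , (λ w≡v → l∉ (there (there (subst (_∈ map lab W) (trans w≡v (lab-vertex pl)) (∈-map⁺ lab w∈W)))))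
      ] (resolver∈pair w (vertex k) (vertex l) u≢v collision res)
      where
      pk : VertexLabel k
      pk = ∉⇒vertexLabel k∉
      pl : VertexLabel l
      pl = ∉⇒vertexLabel l∉
      u≢v : lab (vertex k) ≢ lab (vertex l)
      u≢v e′ = k≢l (trans (sym (lab-vertex pk)) (trans e′ (lab-vertex pl)))
      collision : S (vertex k) ≡ S (vertex l) ⊎ Disjoint (S (vertex k)) (S (vertex l))
      collision = subst₂ (λ i j → supp L i ≡ supp L j ⊎ Disjoint (supp L i) (supp L j))
        (sym (lab-vertex pk)) (sym (lab-vertex pl)) (normalise-collision _ _ e)

    |C|≤ : length C ≤ 2 ^ N
    |C|≤ = subst₂ _≤_ (length-map (normalise ∘ supp L) C) (length-boolVecs N) (unique-⊆⇒length≤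
      (allPairs-map⁺ unresolved-collision (others-∉ X) (others-unique X)) (λ {v} _ → ∈-boolVecs v))

    resolvingSet-lowerBound : K ∸ 2 ^ N ∸ 2 ≤ length W
    -- `K ≤ 2 ^ N + (2 + length W)`, where the 2 counts the zero ideal and the whole ring.
    resolvingSet-lowerBound = m≤n+o⇒m∸n≤o (K ∸ 2 ^ N) 2 (m≤n+o⇒m∸n≤o K (2 ^ N) (≤-trans (K≤ X)
      (≤-trans (≤-reflexive (ℕ.+-comm (length X) (length C)))
        (+-mono-≤ |C|≤ (≤-reflexive (cong (2 +_) (length-map lab W)))))))

  -- A strong resolving set attaining the bound

  private
    -- `Y` holds what is left out of `W₀`: the two non-vertices and one chosen ideal for each
    -- support through the first coordinate.
    sections Y Z : List (Fin K)
    sections = map (λ v → sec L (true ∷ v)) (boolVecs N)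
    Y = bot ∷ top ∷ sections
    Z = others Y

    W₀ : List (Vertex A)
    W₀ = map vertex Z

    section-vertexLabel : ∀ {v} → ¬ Disjoint v v → VertexLabel (sec L v)
    section-vertexLabel {v} v≠∅ =
      subst VertexLabel (label-ideal (sec L v)) (lab-vertexLabel (sectionVertex v v≠∅))

    sec-injective : ∀ {v w} → sec L v ≡ sec L w → v ≡ w
    sec-injective {v} {w} e = trans (sym (supp-sec L v)) (trans (cong (supp L) e) (supp-sec L w))

    Y-unique : Unique Y
    Y-unique = (bot≢top ∷ All.map (≢-sym ∘ proj₁) sections-vertexLabel) ∷
      All.map (≢-sym ∘ proj₂) sections-vertexLabel ∷
      Unique.map⁺ (∷-injectiveʳ ∘ sec-injective) (boolVecs-unique N)
      where
      bot≢top : bot ≢ top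
      bot≢top e = proj₂ (proj₂ full) (∈-resp (proj₁ full)
        (CommutativeRing.sym A (lower (proj₂ (label-injective (zeroIdeal A) (unitIdeal A) e) 1# _)))
        (0∈ (proj₁ full)))
      sections-vertexLabel : All VertexLabel sections
      sections-vertexLabel = All.map⁺ (All.universal (λ v → section-vertexLabel λ { (() ∷ _) }) (boolVecs N))

    |W₀| : length W₀ ≡ K ∸ 2 ^ N ∸ 2
    |W₀| = sym (trans (∸-+-assoc K (2 ^ N) 2) (trans
      -- Since `Y` has no repetitions, its length `2 + 2 ^ N` and that of `Z` add up to exactly `K`.
      (cong₂ _∸_ (sym (≤-antisym (≤K Y-unique) (K≤ Y)))
        (trans (ℕ.+-comm (2 ^ N) 2) (cong (2 +_) (sym (trans (length-map _ (boolVecs N)) (length-boolVecs N))))))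
      (trans (m+n∸m≡n (length Y) (length Z)) (sym (length-map vertex Z)))))

    W₀-distinct : DistinctVertices A W₀
    W₀-distinct = allPairs-map⁺
      (λ {k} {l} k∉ l∉ k≢l e → k≢l (trans (sym (lab-vertex (∉⇒vertexLabel k∉)))
        (trans (label-cong (proj₁ (vertex k)) (proj₁ (vertex l)) e) (lab-vertex (∉⇒vertexLabel l∉)))))
      (others-∉ Y) (others-unique Y)

    resolvedAt : ∀ {u v l} → l ∉ Y → StronglyResolves A (vertex l) u v →
      Any (λ w → StronglyResolves A w u v) W₀
    resolvedAt l∉Y = Any.map⁺ ∘ lose (∈-others l∉Y)

    ∈Y⇒section : ∀ u → lab u ∈ Y → ∃ λ v → lab u ≡ sec L (true ∷ v)
    ∈Y⇒section u (here e) = contradiction e (proj₁ (lab-vertexLabel u))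
    ∈Y⇒section u (there (here e)) = contradiction e (proj₂ (lab-vertexLabel u))
    ∈Y⇒section u (there (there p)) = let (v , _ , e) = ∈-map⁻ _ p in v , e

    -- Two sections are told apart by any vertex whose support meets exactly one of theirs.
    resolveSections : ∀ u v a b e → lab u ≡ sec L (true ∷ a) → lab v ≡ sec L (true ∷ b) →
      ¬ Disjoint e a → Disjoint e b → Any (λ w → StronglyResolves A w u v) W₀
    resolveSections u v a b e u≡ v≡ e∩a e⊥b = resolvedAt {u} {v} w∉Y
      (between-resolves (vertex l) u v w≢u
        (λ d → e∩a (Pointwise.tail (subst₂ Disjoint Sw Su d)))
        (subst₂ Disjoint (sym Sw) (sym Sv) (refl ∷ e⊥b))
        (λ u≡v → e∩a (subst (Disjoint e)
          (∷-injectiveʳ (trans (sym Sv) (trans (cong (supp L) (sym u≡v)) Su))) e⊥b))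
        (λ d → case subst₂ Disjoint Su Sv d of λ { (() ∷ _) }))
      where
      l : Fin K
      -- The leading `false` keeps `l` out of `Y`, whose sections all start with `true`, and leaves
      -- the separation to `e`.
      l = sec L (false ∷ e)
      l-vertex : VertexLabel l
      l-vertex = section-vertexLabel λ { (_ ∷ d) → e∩a (disjoint-self d a) }
      Sw : S (vertex l) ≡ false ∷ e
      Sw = trans (cong (supp L) (lab-vertex l-vertex)) (supp-sec L _)
      Su : S u ≡ true ∷ a
      Su = trans (cong (supp L) u≡) (supp-sec L _)
      Sv : S v ≡ true ∷ b
      Sv = trans (cong (supp L) v≡) (supp-sec L _)
      w≢u : lab (vertex l) ≢ lab u
      w≢u p = case trans (sym Sw) (trans (cong (supp L) p) Su) of λ ()
      w∉Y : l ∉ Y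
      w∉Y (here p) = proj₁ l-vertex p
      w∉Y (there (here p)) = proj₂ l-vertex p
      w∉Y (there (there p)) = case sec-injective (proj₂ (proj₂ (∈-map⁻ _ p))) of λ ()

    -- A vertex with label outside `Y` is represented in `W₀` and resolves every pair it belongs to.
    -- Two distinct vertices with labels in `Y` have different supports, to which `separate`
    -- applies.
    W₀-resolving : IsStrongResolvingSet A W₀
    W₀-resolving u v u≠v with lab u ∈? Y | lab v ∈? Y
    ... | no u∉Y | _ = resolvedAt {u} {v} u∉Y
      (self-resolves (vertex (lab u)) u v (lab-vertex (lab-vertexLabel u)))
    ... | yes _ | no v∉Y = resolvedAt {u} {v} v∉Y (Sum.swap
      (self-resolves (vertex (lab v)) v u (lab-vertex (lab-vertexLabel v))))
    ... | yes u∈Y | yes v∈Y with ∈Y⇒section u u∈Y | ∈Y⇒section v v∈Y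
    ... | a , u≡ | b , v≡ with separate a b (λ a≡b → u≠v (label-injective (proj₁ u) (proj₁ v)
                                 (trans u≡ (trans (cong (λ x → sec L (true ∷ x)) a≡b) (sym v≡)))))
    ... | e , inj₁ (e∩a , e⊥b) = resolveSections u v a b e u≡ v≡ e∩a e⊥b
    ... | e , inj₂ (e⊥a , e∩b) = Any.map Sum.swap
      (resolveSections v u b a e v≡ u≡ e∩b e⊥a)

  sdim : SDimIs A (K ∸ 2 ^ N ∸ 2)
  sdim = (W₀ , W₀-distinct , W₀-resolving , |W₀|) , λ W _ → resolvingSet-lowerBound W

-- Assembling the formula

nonemptyProduct≡product : ∀ k f → nonemptyProduct k f ≡ product (map f (allFin (suc k)))
nonemptyProduct≡product k f = trans (tabulated k f) (cong product (sym (map-tabulate id f)))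
  where
  tabulated : ∀ k f → nonemptyProduct k f ≡ product (List.tabulate f)
  tabulated zero f = sym (ℕ.*-identityʳ (f zero))
  tabulated (suc k) f = cong (f zero *_) (tabulated k (f ∘ suc))

nonemptyProduct-const : ∀ k n → nonemptyProduct k (λ _ → n) ≡ n ^ suc k
nonemptyProduct-const zero n = sym (ℕ.*-identityʳ n)
nonemptyProduct-const (suc k) n = cong (n *_) (nonemptyProduct-const k n)

theorem3p10 : ∀ {c ℓ : Level} (m′ n′ : ℕ)
    (R : CommutativeRing c ℓ)
    (Rs : Fin (suc m′) → CommutativeRing c ℓ)
    (Fs : Fin (suc n′) → CommutativeRing c ℓ)
    (ns : Fin (suc m′) → ℕ) →
    (∀ i → IsLocal (Rs i)) →
    (∀ i → IsPrincipalIdealRing (Rs i)) →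
    (∀ i → HasFinitelyManyIdeals (Rs i)) →
    (∀ i → ¬ IsField (Rs i)) →
    (∀ j → IsField (Fs j)) →
    (∀ i → NumNontrivialIdeals (Rs i) (ns i)) →
    R ≅R (ΠRing m′ Rs ×R ΠRing n′ Fs) →
    SDimIs R (product (map (λ i → ns i + 2) (allFin (suc m′))) * 2 ^ suc n′
              ∸ 2 ^ (suc m′ + suc n′ ∸ 1) ∸ 2)
theorem3p10 {c} {ℓ} m′ n′ R Rs Fs ns local pir fin ¬field field′ num R≅ =
  -- Supports have length `suc m′ + suc n′`, so `N` is `m′ + suc n′`, to which the exponent in the
  -- goal reduces.
  subst (λ K → SDimIs R (K ∸ 2 ^ (m′ + suc n′) ∸ 2))
    (cong₂ _*_ (nonemptyProduct≡product m′ (λ i → ns i + 2)) (nonemptyProduct-const n′ 2))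
    (sdim (≅-labelling R≅ (×-labelling LS LT))
      (≅-properSection {A = R} {B = ΠRing m′ Rs ×R ΠRing n′ Fs} R≅
        (×-labelling LS LT) (×-properSection LS LT properS)))
  where
  em : ExcludedMiddle (c ⊔ ℓ)
  em = principal⇒excludedMiddle (Rs zero) (local⇒1≉0 (Rs zero) (local zero)) (pir zero)
  labellings : ∀ i → Σ (IdealLabelling (Rs i) 1 (ns i + 2)) ProperSection
  labellings i = subst (λ k → Σ (IdealLabelling (Rs i) 1 k) ProperSection) (ℕ.+-comm 2 (ns i))
    (localLabelling (Rs i) em (local i) (pir i) (fin i) (¬field i) (num i))
  LS : IdealLabelling (ΠRing m′ Rs) (suc m′) (nonemptyProduct m′ (λ i → ns i + 2))
  LS = Π-labelling m′ Rs _ (proj₁ ∘ labellings)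
  LT : IdealLabelling (ΠRing n′ Fs) (suc n′) (nonemptyProduct n′ (λ _ → 2))
  LT = Π-labelling n′ Fs _ (λ j → fieldLabelling (Fs j) em (field′ j))
  -- Properness is carried by the first local factor, the leftmost coordinate of the product.
  properS : ProperSection LS
  properS = Π-properSection m′ Rs _ (proj₁ ∘ labellings) (proj₂ (labellings zero))
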